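{- Let $Q=T[H_1,\dots,H_t]$ be a semicomplete composition. Then $Q$ contains an acyclic spanning subdigraph $R$ with a source $x$ and a sink $y$ such that for each vertex $z$ of $Q$, $R$ contains an $x$--$z$ path and a $z$--$y$ path, if one of the following assertions holds: (a) $Q$ is non-strong and has both in- and out-branchings (i.e., at least one in-branching and at least one out-branching); (b) $Q$ is strong with $|V(H_i)|\ge 2$ for each $i\in\{1,\dots,t\}$.
   Context: Digraphs are finite, without loops or parallel arcs (2-cycles are allowed); paths and cycles are directed, and a single vertex is a (trivial) path. A digraph is semicomplete if there is at least one arc between every pair of distinct vertices. Let $T$ be a digraph with vertices $u_1,\dots,u_t$ ($t\ge 2$) and let $H_1,\dots,H_t$ be pairwise disjoint nonempty digraphs. The composition $Q=T[H_1,\dots,H_t]$ is the digraph with vertex set $\bigcup_i V(H_i)$ and arc set $\bigcup_{i=1}^t A(H_i)\cup\{xy : x\in V(H_i),\ y\in V(H_p),\ u_iu_p\in A(T)\}$. It is a semicomplete composition if $T$ is semicomplete. A digraph is strong if for every ordered pair of vertices $(x,y)$ there is a directed path from $x$ to $y$. A digraph is acyclic if it has no directed cycle (including 2-cycles). A source (resp. sink) is a vertex of in-degree zero (resp. out-degree zero). An out-tree (resp. in-tree) rooted at $r$ is an orientation of a tree in which every vertex except $r$ has in-degree (resp. out-degree) one. An out-branching (resp. in-branching) of $D$ is a spanning subdigraph of $D$ which is an out-tree (resp. in-tree). -}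

module Defs where

open import Data.Fin.Base using (Fin; zero; suc)
open import Data.Fin.Properties using (+↔⊎; inj⇒≟)
open import Data.List.Base using (List; []; _∷_; length; filter; tabulate)
open import Data.List.Relation.Unary.Unique.Propositional using (Unique)
open import Data.Nat.Base using (ℕ; zero; suc; _+_; _≤_)
open import Data.Product.Base using (Σ; Σ-syntax; ∃-syntax; _×_; _,_; proj₁)
open import Data.Product.Function.Dependent.Propositional using (Σ-↔)
open import Data.Sum.Base using (_⊎_; inj₁; inj₂)
open import Data.Sum.Function.Propositional using (_⊎-↔_)
open import Data.Vec.Functional using (foldr)
open import Function.Base using (_∘_)
open import Function.Bundles using (_↔_; Inverse; mk↔ₛ′)
open import Function.Construct.Identity using (↔-id)
open import Function.Construct.Composition using (_↔-∘_)
open import Function.Construct.Symmetry using (↔-sym)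
open import Function.Properties.Inverse using (↔⇒↣)
open import Level using (0ℓ)
open import Relation.Binary.Construct.Closure.ReflexiveTransitive using (Star; ε; _◅_)
open import Relation.Binary.Construct.Closure.Symmetric using (SymClosure)
open import Relation.Binary.Core using (Rel)
open import Relation.Binary.Definitions using (Decidable; DecidableEquality)
open import Relation.Binary.PropositionalEquality using (_≡_; _≢_; refl)
open import Relation.Nullary using (¬_; yes; no)

-- Arcs form a relation, so there are no parallel arcs. Decidability of
-- adjacency is what makes the arc set, and not only the vertex set, finite
-- constructively.
record Digraph : Set₁ where
  field
    V       : Set
    order   : ℕ
    enum    : V ↔ Fin order
    Arc     : Rel V 0ℓ
    arc?    : Decidable Arc
    no-loop : ∀ {x} → ¬ Arc x x

  _≟V_ : DecidableEquality V
  _≟V_ = inj⇒≟ (↔⇒↣ enum)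

  vertices : List V
  vertices = tabulate (Inverse.from enum)

  inDegree outDegree : V → ℕ
  inDegree  x = length (filter (λ w → arc? w x) vertices)
  outDegree x = length (filter (λ w → arc? x w) vertices)

  IsSource IsSink : V → Set
  IsSource x = inDegree x ≡ 0
  IsSink   x = outDegree x ≡ 0

open Digraph public using (V; order; Arc)

-- Paths and cycles in an arbitrary relation, used both for the arcs of a
-- digraph and for the edges of its underlying undirected graph.
module _ {A : Set} {_⟶_ : Rel A 0ℓ} where

  walkVertices : ∀ {x y} → Star _⟶_ x y → List A
  walkVertices {x} ε       = x ∷ []
  walkVertices {x} (_ ◅ w) = x ∷ walkVertices w

Path : {A : Set} → Rel A 0ℓ → Rel A 0ℓ
Path _⟶_ x y = Σ[ w ∈ Star _⟶_ x y ] Unique (walkVertices w)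

-- A cycle with at least k vertices: a path x … y closed up by a step y ⟶ x.
Cycle : {A : Set} → ℕ → Rel A 0ℓ → Set
Cycle k _⟶_ =
  ∃[ x ] ∃[ y ] Σ[ p ∈ Path _⟶_ x y ] (k ≤ length (walkVertices (proj₁ p)) × y ⟶ x)

Semicomplete : Digraph → Set
Semicomplete D = ∀ (x y : V D) → x ≢ y → Arc D x y ⊎ Arc D y x

Strong : Digraph → Set
Strong D = ∀ (x y : V D) → Path (Arc D) x y

Acyclic : Digraph → Set
Acyclic D = ¬ Cycle 2 (Arc D)

record SpanningSubdigraph (D : Digraph) : Set₁ where
  field
    SubArc  : Rel (V D) 0ℓ
    subArc? : Decidable SubArc
    subArc⊆ : ∀ {x y} → SubArc x y → Arc D x y

  digraph : Digraph
  digraph = record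
    { V       = V D
    ; order   = order D
    ; enum    = Digraph.enum D
    ; Arc     = SubArc
    ; arc?    = subArc?
    ; no-loop = λ a → Digraph.no-loop D (subArc⊆ a)
    }

-- Edges of the underlying undirected graph.
Edge : (D : Digraph) → Rel (V D) 0ℓ
Edge D = SymClosure (Arc D)

record IsOrientedTree (D : Digraph) : Set where
  field
    oriented  : ∀ {x y : V D} → Arc D x y → ¬ Arc D y x
    connected : ∀ (x y : V D) → Path (Edge D) x y
    noCycle   : ¬ Cycle 3 (Edge D)

IsOutTree IsInTree : (D : Digraph) → V D → Set
IsOutTree D r = IsOrientedTree D × (∀ v → v ≢ r → Digraph.inDegree D v ≡ 1)
IsInTree  D r = IsOrientedTree D × (∀ v → v ≢ r → Digraph.outDegree D v ≡ 1)

HasOutBranching HasInBranching : Digraph → Set₁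
HasOutBranching D =
  Σ[ B ∈ SpanningSubdigraph D ] ∃[ r ] IsOutTree (SpanningSubdigraph.digraph B) r
HasInBranching D =
  Σ[ B ∈ SpanningSubdigraph D ] ∃[ r ] IsInTree (SpanningSubdigraph.digraph B) r

Σ-Fin↔ : ∀ {n} (f : Fin n → ℕ) → Σ (Fin n) (Fin ∘ f) ↔ Fin (foldr _+_ 0 f)
Σ-Fin↔ {zero}  f = mk↔ₛ′ (λ { (() , _) }) (λ ()) (λ ()) (λ { (() , _) })
Σ-Fin↔ {suc n} f = ↔-sym +↔⊎ ↔-∘ ((↔-id _ ⊎-↔ Σ-Fin↔ (f ∘ suc)) ↔-∘ split)
  where
  split : Σ (Fin (suc n)) (Fin ∘ f) ↔ (Fin (f zero) ⊎ Σ (Fin n) (Fin ∘ f ∘ suc))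
  split = mk↔ₛ′
    (λ { (zero , k) → inj₁ k ; (suc i , k) → inj₂ (i , k) })
    (λ { (inj₁ k) → zero , k ; (inj₂ (i , k)) → suc i , k })
    (λ { (inj₁ _) → refl ; (inj₂ _) → refl })
    (λ { (zero , _) → refl ; (suc _ , _) → refl })

-- T[H₁,…,H_t], with the H_i indexed by the vertices of T. The Σ-type makes
-- their vertex sets disjoint.
module Composition (T : Digraph) (H : V T → Digraph) where

  CompV : Set
  CompV = Σ (V T) (λ i → V (H i))

  data CompArc : Rel CompV 0ℓ where
    inner : ∀ {i x y} → Arc (H i) x y → CompArc (i , x) (i , y)
    outer : ∀ {i p x y} → Arc T i p → CompArc (i , x) (p , y)

  compArc? : Decidable CompArc
  compArc? (i , x) (p , y) with Digraph.arc? T i p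
  ... | yes a = yes (outer a)
  ... | no ¬a with Digraph._≟V_ T i p
  ...   | no i≢p = no λ { (inner _) → i≢p refl ; (outer a) → ¬a a }
  ...   | yes refl with Digraph.arc? (H i) x y
  ...     | yes b = yes (inner b)
  ...     | no ¬b = no λ { (inner b) → ¬b b ; (outer a) → ¬a a }

  compNoLoop : ∀ {v} → ¬ CompArc v v
  compNoLoop {i , _} (inner a) = Digraph.no-loop (H i) a
  compNoLoop         (outer a) = Digraph.no-loop T a

  orders : Fin (order T) → ℕ
  orders j = order (H (Inverse.from (Digraph.enum T) j))

  compEnum : CompV ↔ Fin (foldr _+_ 0 orders)
  compEnum = Σ-Fin↔ orders ↔-∘
    ↔-sym (Σ-↔ (↔-sym (Digraph.enum T)) (λ {j} → ↔-sym (Digraph.enum (H (Inverse.from (Digraph.enum T) j)))))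

  composition : Digraph
  composition = record
    { V       = CompV
    ; order   = foldr _+_ 0 orders
    ; enum    = compEnum
    ; Arc     = CompArc
    ; arc?    = compArc?
    ; no-loop = compNoLoop
    }

open Composition public using (composition)

{-# OPTIONS --safe #-}

-- Suppose the vertices of a digraph split into two parts such that some r
-- reaches every lower vertex inside the lower part, every upper vertex reaches
-- some s inside the upper part, every lower vertex has an upper out-neighbour
-- and every upper vertex has a lower in-neighbour.  Order the lower vertices by
-- increasing distance from r and put after them the upper vertices by decreasing
-- distance to s.  Every vertex but r has a smaller in-neighbour and every vertex
-- but s has a larger out-neighbour, so the arcs that go up in this order form
-- the required subdigraph.
--
-- In case (a), let r ∈ H_p and s ∈ H_q be roots of an out- and an in-branching.
-- The lower part consists of the H_i such that u_i reaches u_p in T; it omits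
-- H_q, since otherwise Q would be strong.  As T is semicomplete, every lower
-- vertex dominates s and r dominates every upper vertex.
--
-- In case (b), fix a_i ≠ b_i in each H_i and let the lower part be the set of
-- the a_i, with r = a_p and s = b_p for any p.  A walk of positive length in T
-- lifts to a walk in Q with arbitrary ends and interior vertices among the a_i,
-- or among the b_i.
module Submission where

open import Defs
open import Data.Bool.Base using (if_then_else_)
open import Data.Fin.Base using (zero; suc; punchIn) renaming (_<_ to _<ᶠ_)
open import Data.Fin.Induction using (po-wellFounded)
open import Data.Fin.Properties using (any?; pigeonhole; punchInᵢ≢i)
open import Data.List.Base using (List; []; _∷_; length; filter; lookup)
open import Data.List.Membership.Propositional using (_∈_)
open import Data.List.Membership.Propositional.Properties using (∈-lookup; ∈-filter⁻)
import Data.List.Membership.DecPropositional as DecMembership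
open import Data.List.Properties using (filter-none)
open import Data.List.Relation.Unary.All as All using ([]; _∷_)
open import Data.List.Relation.Unary.All.Properties using (¬Any⇒All¬)
open import Data.List.Relation.Unary.AllPairs using (AllPairs; []; _∷_)
open import Data.List.Relation.Unary.Any using (here; there)
open import Data.List.Relation.Unary.Unique.Propositional using (Unique)
open import Data.Nat.Base using (ℕ; zero; suc; _≤_; _<_; _>_; z≤n; s≤s; s<s)
open import Data.Nat.Properties using (_<?_; _>?_; <-isStrictPartialOrder; ≤-trans; <⇒≤; ≮⇒≥)
open import Data.Product.Base using (∃-syntax; Σ-syntax; _×_; _,_; proj₁; proj₂; ∃)
open import Data.Sum.Base using (_⊎_; inj₁; inj₂)
open import Data.Sum.Relation.Binary.LeftOrder
  using (_⊎-<_; ₁∼₁; ₁∼₂; ₂∼₂; ⊎-<-decidable; ⊎-<-isStrictPartialOrder)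
open import Data.Sum.Relation.Binary.Pointwise using (Pointwise)
open import Data.Unit.Base using (tt)
open import Function.Base using (_∘_; _on_; case_of_; flip; id)
open import Function.Bundles using (Injection; Inverse)
open import Function.Properties.Inverse using (↔⇒↣)
open import Induction.WellFounded using (Acc; acc; WellFounded; module Subrelation)
open import Level using (0ℓ)
open import Relation.Binary.Construct.Closure.ReflexiveTransitive as Star using (Star; ε; _◅_; _◅◅_)
import Relation.Binary.Construct.Closure.ReflexiveTransitive.Properties as Starₚ
open import Relation.Binary.Construct.Closure.Symmetric using (fwd)
open import Relation.Binary.Construct.Closure.Transitive using (TransClosure; [_]; _∷_)
import Relation.Binary.Construct.Flip.EqAndOrd as Flip
open import Relation.Binary.Construct.Intersection using (_∩_)
import Relation.Binary.Construct.On as On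
open import Relation.Binary.Core using (Rel; _⇒_)
open import Relation.Binary.Definitions using (Asymmetric; Decidable; DecidableEquality)
open import Relation.Binary.PropositionalEquality using (_≡_; _≢_; refl; sym; cong; subst; subst₂; ≢-sym)
open import Relation.Binary.Structures using (IsPartialOrder; IsStrictPartialOrder)
open import Relation.Nullary using (¬_; Dec; does; yes; no; ¬?; contradiction; _×-dec_)
open import Relation.Nullary.Decidable using (map′; dec-true; dec-false)
open import Relation.Unary as U using (Pred; ∁)

-- Walks and paths

module _ {a ℓ} {A : Set a} {_⟶_ : Rel A ℓ} where

  infixr 5 _◅⁺_

  _◅⁺_ : ∀ {x y z} → x ⟶ y → Star _⟶_ y z → TransClosure _⟶_ x z
  a ◅⁺ ε       = [ a ]
  a ◅⁺ (b ◅ w) = a ∷ b ◅⁺ w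

  first-step : ∀ {x y} → TransClosure _⟶_ x y → ∃[ z ] x ⟶ z
  first-step [ a ]   = _ , a
  first-step (a ∷ _) = _ , a

  last-step : ∀ {x y} → TransClosure _⟶_ x y → ∃[ z ] z ⟶ y
  last-step [ a ]   = _ , a
  last-step (_ ∷ w) = last-step w

Within : ∀ {a p} {A : Set a} → Pred A p → Rel A p
Within P x y = P x × P y

forward-closed⇒within : ∀ {a ℓ p} {A : Set a} {_⟶_ : Rel A ℓ} {P : Pred A p} →
  (∀ {x y} → x ⟶ y → P x → P y) → ∀ {x y} → Star _⟶_ x y → P x → Star (_⟶_ ∩ Within P) x y
forward-closed⇒within closed ε       _  = ε
forward-closed⇒within closed (a ◅ w) Px =
  (a , Px , closed a Px) ◅ forward-closed⇒within closed w (closed a Px)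

backward-closed⇒within : ∀ {a ℓ p} {A : Set a} {_⟶_ : Rel A ℓ} {P : Pred A p} →
  (∀ {x y} → x ⟶ y → P y → P x) → ∀ {x y} → Star _⟶_ x y → P y → Star (_⟶_ ∩ Within P) x y
backward-closed⇒within closed w Py =
  Star.reverse (λ (a , Py , Px) → a , Px , Py)
    (forward-closed⇒within closed (Star.reverse id w) Py)

module _ {A : Set} {_⟶_ : Rel A 0ℓ} where

  walkVertices-nonempty : ∀ {x y} (w : Star _⟶_ x y) → 1 ≤ length (walkVertices w)
  walkVertices-nonempty ε       = s≤s z≤n
  walkVertices-nonempty (_ ◅ _) = s≤s z≤n

  path-suffix : ∀ {x y z} (w : Star _⟶_ x y) → Unique (walkVertices w) →
    z ∈ walkVertices w → Path _⟶_ z y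
  path-suffix ε       w!       (here refl) = ε , w!
  path-suffix (a ◅ w) w!       (here refl) = a ◅ w , w!
  path-suffix (_ ◅ w) (_ ∷ w!) (there z∈w) = path-suffix w w! z∈w

  walk⇒path : DecidableEquality A → Star _⟶_ ⇒ Path _⟶_
  walk⇒path _≟_ ε = ε , [] ∷ []
  walk⇒path _≟_ {x} (a ◅ w) with walk⇒path _≟_ w
  ... | p , p! with DecMembership._∈?_ _≟_ x (walkVertices p)
  ...   | yes x∈p = path-suffix p p! x∈p
  ...   | no  x∉p = a ◅ p , ¬Any⇒All¬ _ x∉p ∷ p!

  asymmetric⇒Cycle₃ : Asymmetric _⟶_ → ∀ {k} → Cycle k _⟶_ → Cycle 3 _⟶_
  asymmetric⇒Cycle₃ asym (_ , _ , (ε         , _)  , _ , a) = contradiction a (asym a)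
  asymmetric⇒Cycle₃ asym (_ , _ , (b ◅ ε     , _)  , _ , a) = contradiction a (asym b)
  asymmetric⇒Cycle₃ asym (_ , _ , (b ◅ c ◅ w , p!) , _ , a) =
    _ , _ , (b ◅ c ◅ w , p!) , s≤s (s≤s (walkVertices-nonempty w)) , a

walkVertices-map : ∀ {A : Set} {R S : Rel A 0ℓ} (R⇒S : R ⇒ S) {x y} (w : Star R x y) →
  walkVertices (Star.map R⇒S w) ≡ walkVertices w
walkVertices-map R⇒S ε       = refl
walkVertices-map R⇒S (_ ◅ w) = cong (_ ∷_) (walkVertices-map R⇒S w)

Cycle-map : ∀ {A : Set} {R S : Rel A 0ℓ} → R ⇒ S → ∀ {k} → Cycle k R → Cycle k S
Cycle-map R⇒S {k} (x , y , (w , w!) , k≤∣w∣ , a) =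
  x , y , (Star.map R⇒S w , subst Unique (sym same-vertices) w!) ,
  subst (λ vs → k ≤ length vs) (sym same-vertices) k≤∣w∣ , R⇒S a
  where
  same-vertices : walkVertices (Star.map R⇒S w) ≡ walkVertices w
  same-vertices = walkVertices-map R⇒S w

AllPairs-lookup : ∀ {a ℓ} {A : Set a} {R : Rel A ℓ} {xs : List A} → AllPairs R xs →
  ∀ {i j} → i <ᶠ j → R (lookup xs i) (lookup xs j)
AllPairs-lookup (px ∷ _)   {zero}  {suc j} _         = All.lookup px (∈-lookup j)
AllPairs-lookup (_  ∷ pxs) {suc i} {suc j} (s<s i<j) = AllPairs-lookup pxs i<j

-- Vertices, degrees and constructions of digraphs

module _ (D : Digraph) where

  open Digraph D using (enum; arc?; no-loop; _≟V_; vertices; IsSource)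
  open Inverse enum using (to; from; inverseˡ; strictlyInverseʳ)

  some-vertex : 1 ≤ order D → V D
  some-vertex (s≤s _) = from zero

  other-vertex : 2 ≤ order D → (x : V D) → ∃[ y ] x ≢ y
  other-vertex (s≤s (s≤s _)) x =
    from (punchIn (to x) zero) , λ x≡y → punchInᵢ≢i (to x) zero (sym (inverseˡ x≡y))

  ∃-vertex? : ∀ {P : Pred (V D) 0ℓ} → U.Decidable P → Dec (∃ P)
  ∃-vertex? {P} P? = map′ (λ (i , Pi) → from i , Pi)
                          (λ (x , Px) → to x , subst P (sym (strictlyInverseʳ x)) Px)
                          (any? (P? ∘ from))

  Unique⇒length≤order : ∀ {xs} → Unique xs → length xs ≤ order D
  Unique⇒length≤order {xs} xs! = ≮⇒≥ λ order<∣xs∣ →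
    let i , j , i<j , same = pigeonhole order<∣xs∣ (to ∘ lookup xs) in
    AllPairs-lookup xs! i<j (Injection.injective (↔⇒↣ enum) same)

  no-in-neighbour⇒source : ∀ {x} → (∀ w → ¬ Arc D w x) → IsSource x
  no-in-neighbour⇒source ¬Arc = cong length (filter-none _ (All.universal ¬Arc vertices))

  nonsource⇒in-neighbour : ∀ {x} → ¬ IsSource x → ∃[ w ] Arc D w x
  nonsource⇒in-neighbour {x} nonsource with filter (λ w → arc? w x) vertices in eq
  ... | []    = contradiction refl nonsource
  ... | w ∷ _ =
    w , proj₂ (∈-filter⁻ (λ w → arc? w x) {xs = vertices} (subst (w ∈_) (sym eq) (here refl)))

  reachable⇒strong : (∀ x y → Star (Arc D) x y) → Strong D
  reachable⇒strong reach x y = walk⇒path _≟V_ (reach x y)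

  converse : Digraph
  converse = record
    { V       = V D
    ; order   = order D
    ; enum    = enum
    ; Arc     = flip (Arc D)
    ; arc?    = flip arc?
    ; no-loop = no-loop
    }

  arcsIn : {E : Rel (V D) 0ℓ} → Decidable E → SpanningSubdigraph D
  arcsIn {E} E? = record
    { SubArc  = Arc D ∩ E
    ; subArc? = λ x y → arc? x y ×-dec E? x y
    ; subArc⊆ = proj₁
    }

  _↾_ : {P : Pred (V D) 0ℓ} → U.Decidable P → Digraph
  _↾_ {P} P? = SpanningSubdigraph.digraph (arcsIn {Within P} λ x y → P? x ×-dec P? y)

-- Distance

-- The result is n if no k < n satisfies P.
least : {P : Pred ℕ 0ℓ} → U.Decidable P → ℕ → ℕ
least P? zero    = zero
least P? (suc n) = if does (P? zero) then zero else suc (least (P? ∘ suc) n)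

least-satisfies : ∀ {P : Pred ℕ 0ℓ} (P? : U.Decidable P) {n k} → k ≤ n → P k → P (least P? n)
least-satisfies P? {zero}  z≤n Pk = Pk
least-satisfies P? {suc n} k≤n Pk with P? zero
least-satisfies P?         _         _  | yes P0 = P0
least-satisfies P?         z≤n       P0 | no ¬P0 = contradiction P0 ¬P0
least-satisfies P?         (s≤s k≤n) Pk | no _   = least-satisfies (P? ∘ suc) k≤n Pk

least-minimal : ∀ {P : Pred ℕ 0ℓ} (P? : U.Decidable P) n {k} → P k → least P? n ≤ k
least-minimal P? zero    Pk = z≤n
least-minimal P? (suc n) Pk with P? zero
least-minimal P? (suc n)         _  | yes _  = z≤n
least-minimal P? (suc n) {zero}  P0 | no ¬P0 = contradiction P0 ¬P0
least-minimal P? (suc n) {suc k} Pk | no _   = s≤s (least-minimal (P? ∘ suc) n Pk)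

module _ (D : Digraph) where

  open Digraph D using (arc?; _≟V_)

  Walk : ℕ → Rel (V D) 0ℓ
  Walk zero    x y = x ≡ y
  Walk (suc k) x y = ∃[ w ] (Arc D x w × Walk k w y)

  walk? : ∀ k → Decidable (Walk k)
  walk? zero    x y = x ≟V y
  walk? (suc k) x y = ∃-vertex? D λ w → arc? x w ×-dec walk? k w y

  Walk⇒Star : ∀ k {x y} → Walk k x y → Star (Arc D) x y
  Walk⇒Star zero    refl        = ε
  Walk⇒Star (suc k) (_ , a , w) = a ◅ Walk⇒Star k w

  Star⇒Walk : ∀ {x y} (w : Star (Arc D) x y) → ∃[ k ] (k < length (walkVertices w) × Walk k x y)
  Star⇒Walk ε       = zero , s≤s z≤n , refl
  Star⇒Walk (a ◅ w) = let k , k<∣w∣ , v = Star⇒Walk w in suc k , s<s k<∣w∣ , _ , a , v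

  -- The junk value for y not reachable from x is the order of D.
  distance : V D → V D → ℕ
  distance x y = least (λ k → walk? k x y) (order D)

  distance-Walk : ∀ {x y} → Star (Arc D) x y → Walk (distance x y) x y
  distance-Walk {x} {y} w =
    let p , p!         = walk⇒path _≟V_ w
        k , k<∣p∣ , v = Star⇒Walk p
    in least-satisfies (λ k → walk? k x y) (<⇒≤ (≤-trans k<∣p∣ (Unique⇒length≤order D p!))) v

  reachable? : Decidable (Star (Arc D))
  reachable? x y = map′ (Walk⇒Star (distance x y)) distance-Walk (walk? (distance x y) x y)

  closer-out-neighbour : ∀ {x y} → Star (Arc D) x y → x ≢ y →
    ∃[ w ] (Arc D x w × distance w y < distance x y)
  closer-out-neighbour {x} {y} w x≢y with distance x y | distance-Walk w
  ... | zero  | x≡y         = contradiction x≡y x≢y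
  ... | suc k | (w , a , v) = w , a , s≤s (least-minimal (λ k → walk? k w y) (order D) v)

-- Acyclic digraphs

module _ (D : Digraph) where

  open Digraph D using (enum; no-loop; _≟V_)
  open Inverse enum using (to; from; strictlyInverseʳ)

  no-return⇒acyclic : (∀ {x y} → Arc D y x → ¬ Star (Arc D) x y) → Acyclic D
  no-return⇒acyclic no-return (_ , _ , (w , _) , _ , a) = no-return a w

  acyclic⇒no-return : Acyclic D → ∀ {x y} → Arc D y x → ¬ Star (Arc D) x y
  acyclic⇒no-return acyclic a w with walk⇒path _≟V_ w
  ... | ε     , _  = no-loop a
  ... | b ◅ p , p! = acyclic (_ , _ , (b ◅ p , p!) , s≤s (walkVertices-nonempty p) , a)

  acyclic⇒reachability-isPartialOrder : Acyclic D → IsPartialOrder _≡_ (Star (Arc D))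
  acyclic⇒reachability-isPartialOrder acyclic = record
    { isPreorder = Starₚ.isPreorder (Arc D)
    ; antisym    = antisym
    }
    where
    antisym : ∀ {x y} → Star (Arc D) x y → Star (Arc D) y x → x ≡ y
    antisym ε       _ = refl
    antisym (a ◅ w) v = contradiction (w ◅◅ v) (acyclic⇒no-return acyclic a)

  acyclic⇒wellFounded : Acyclic D → WellFounded (Arc D)
  acyclic⇒wellFounded acyclic =
    Subrelation.wellFounded arc⇒strictly-reachable (On.wellFounded to (po-wellFounded
      (On.isPartialOrder from (acyclic⇒reachability-isPartialOrder acyclic))))
    where
    arc⇒strictly-reachable : ∀ {x y} → Arc D x y →
      Star (Arc D) (from (to x)) (from (to y)) × from (to x) ≢ from (to y)
    arc⇒strictly-reachable {x} {y} a rewrite strictlyInverseʳ x | strictlyInverseʳ y =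
      a ◅ ε , λ { refl → no-loop a }

  acyclic⇒reachable-from : Acyclic D → ∀ {r} → (∀ z → z ≢ r → ∃[ w ] Arc D w z) →
    ∀ z → Star (Arc D) r z
  acyclic⇒reachable-from acyclic {r} in-neighbour z = go (acyclic⇒wellFounded acyclic z)
    where
    go : ∀ {z} → Acc (Arc D) z → Star (Arc D) r z
    go {z} (acc rs) with z ≟V r
    ... | yes refl = ε
    ... | no  z≢r  = let w , a = in-neighbour z z≢r in go (rs a) ◅◅ a ◅ ε

  acyclic⇒source : Acyclic D → ∀ {r} → (∀ z → Star (Arc D) r z) → Digraph.IsSource D r
  acyclic⇒source acyclic from-r =
    no-in-neighbour⇒source D λ w a → acyclic⇒no-return acyclic a (from-r w)

converse-acyclic : ∀ D → Acyclic D → Acyclic (converse D)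
converse-acyclic D acyclic =
  no-return⇒acyclic (converse D) λ a w → acyclic⇒no-return D acyclic a (Star.reverse id w)

increasing-arcs-acyclic : ∀ D {_≈_ _≺_ : Rel (V D) 0ℓ} → IsStrictPartialOrder _≈_ _≺_ →
  (≺? : Decidable _≺_) → Acyclic (SpanningSubdigraph.digraph (arcsIn D ≺?))
increasing-arcs-acyclic D {_≺_ = _≺_} isSPO ≺? =
  no-return⇒acyclic (SpanningSubdigraph.digraph (arcsIn D ≺?)) λ (_ , y≺x) w →
    SPO.irrefl SPO.Eq.refl (Star.gfoldl id _≺_ (λ y≺u (_ , u≺v) → SPO.trans y≺u u≺v) y≺x w)
  where module SPO = IsStrictPartialOrder isSPO

-- Oriented trees

orientedTree⇒acyclic : ∀ D → IsOrientedTree D → Acyclic D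
orientedTree⇒acyclic D tree cycle = noCycle (Cycle-map fwd (asymmetric⇒Cycle₃ oriented cycle))
  where open IsOrientedTree tree

inDegree≡1⇒reachable-from : ∀ D → Acyclic D → ∀ {r} → (∀ z → z ≢ r → Digraph.inDegree D z ≡ 1) →
  ∀ z → Star (Arc D) r z
inDegree≡1⇒reachable-from D acyclic inDegree≡1 = acyclic⇒reachable-from D acyclic λ z z≢r →
  nonsource⇒in-neighbour D (subst (_≢ 0) (sym (inDegree≡1 z z≢r)) λ ())

outTree⇒reachable-from : ∀ D {r} → IsOutTree D r → ∀ z → Star (Arc D) r z
outTree⇒reachable-from D (tree , inDegree≡1) =
  inDegree≡1⇒reachable-from D (orientedTree⇒acyclic D tree) inDegree≡1

inTree⇒reachable-to : ∀ D {r} → IsInTree D r → ∀ z → Star (Arc D) z r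
inTree⇒reachable-to D (tree , outDegree≡1) z = Star.reverse id
  (inDegree≡1⇒reachable-from (converse D) (converse-acyclic D (orientedTree⇒acyclic D tree))
    outDegree≡1 z)

outBranching⇒reachable-from : ∀ D → HasOutBranching D → ∃[ r ] (∀ z → Star (Arc D) r z)
outBranching⇒reachable-from D (B , r , outTree) =
  r , λ z → Star.map subArc⊆ (outTree⇒reachable-from digraph outTree z)
  where open SpanningSubdigraph B

inBranching⇒reachable-to : ∀ D → HasInBranching D → ∃[ s ] (∀ z → Star (Arc D) z s)
inBranching⇒reachable-to D (B , s , inTree) =
  s , λ z → Star.map subArc⊆ (inTree⇒reachable-to digraph inTree z)
  where open SpanningSubdigraph B

-- Bipolar subdigraphs

IsBipolar : (D : Digraph) → Rel (V D) 0ℓ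
IsBipolar D x y =
  Digraph.IsSource D x × Digraph.IsSink D y × (∀ z → Path (Arc D) x z × Path (Arc D) z y)

HasAcyclicBipolarSubdigraph : Digraph → Set₁
HasAcyclicBipolarSubdigraph D =
  Σ[ S ∈ SpanningSubdigraph D ]
    let R = SpanningSubdigraph.digraph S in
    Acyclic R × (∃[ x ] ∃[ y ] IsBipolar R x y)

acyclic⇒bipolar : ∀ D → Acyclic D → ∀ {x y} →
  (∀ z → z ≢ x → ∃[ w ] Arc D w z) → (∀ z → z ≢ y → ∃[ w ] Arc D z w) → IsBipolar D x y
acyclic⇒bipolar D acyclic {x} {y} in-neighbour out-neighbour =
  acyclic⇒source D acyclic from-x ,
  acyclic⇒source (converse D) (converse-acyclic D acyclic) from-y ,
  λ z → walk⇒path _≟V_ (from-x z) , walk⇒path _≟V_ (Star.reverse id (from-y z))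
  where
  open Digraph D using (_≟V_)
  from-x : ∀ z → Star (Arc D) x z
  from-x = acyclic⇒reachable-from D acyclic in-neighbour
  from-y : ∀ z → Star (Arc (converse D)) y z
  from-y = acyclic⇒reachable-from (converse D) (converse-acyclic D acyclic) out-neighbour

strictPartialOrder⇒bipolarSubdigraph : ∀ D {_≈_ _≺_ : Rel (V D) 0ℓ} →
  IsStrictPartialOrder _≈_ _≺_ → Decidable _≺_ → ∀ {x y} →
  (∀ z → z ≢ x → ∃[ w ] (Arc D ∩ _≺_) w z) → (∀ z → z ≢ y → ∃[ w ] (Arc D ∩ _≺_) z w) →
  HasAcyclicBipolarSubdigraph D
strictPartialOrder⇒bipolarSubdigraph D isSPO ≺? smaller-in-neighbour larger-out-neighbour =
  arcsIn D ≺? , acyclic , _ , _ ,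
  acyclic⇒bipolar (SpanningSubdigraph.digraph (arcsIn D ≺?)) acyclic
    smaller-in-neighbour larger-out-neighbour
  where
  acyclic : Acyclic (SpanningSubdigraph.digraph (arcsIn D ≺?))
  acyclic = increasing-arcs-acyclic D isSPO ≺?

record BipolarPartition (D : Digraph) : Set₁ where
  field
    Lower               : Pred (V D) 0ℓ
    lower?              : U.Decidable Lower
    r s                 : V D
    from-r              : ∀ {z} → Lower z → Star (Arc D ∩ Within Lower) r z
    to-s                : ∀ {z} → ¬ Lower z → Star (Arc D ∩ Within (∁ Lower)) z s
    upper-out-neighbour : ∀ {z} → Lower z → ∃[ w ] (Arc D z w × ¬ Lower w)
    lower-in-neighbour  : ∀ {z} → ¬ Lower z → ∃[ w ] (Arc D w z × Lower w)

module _ {D : Digraph} (partition : BipolarPartition D) where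

  open BipolarPartition partition

  private

    LowerPart UpperPart : Digraph
    LowerPart = D ↾ lower?
    UpperPart = D ↾ (¬? ∘ lower?)

    depth height : V D → ℕ
    depth  z = distance (converse LowerPart) z r
    height z = distance UpperPart z s

    rank : V D → ℕ ⊎ ℕ
    rank z = if does (lower? z) then inj₁ (depth z) else inj₂ (height z)

    rank-lower : ∀ {z} → Lower z → rank z ≡ inj₁ (depth z)
    rank-lower {z} z∈Lower rewrite dec-true (lower? z) z∈Lower = refl

    rank-upper : ∀ {z} → ¬ Lower z → rank z ≡ inj₂ (height z)
    rank-upper {z} z∉Lower rewrite dec-false (lower? z) z∉Lower = refl

    _⊏_ : Rel (ℕ ⊎ ℕ) 0ℓ
    _⊏_ = _<_ ⊎-< _>_

    _≺_ : Rel (V D) 0ℓ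
    _≺_ = _⊏_ on rank

    _≺?_ : Decidable _≺_
    _≺?_ = On.decidable rank _⊏_ (⊎-<-decidable _<?_ _>?_)

    ≺-isStrictPartialOrder : IsStrictPartialOrder (Pointwise _≡_ _≡_ on rank) _≺_
    ≺-isStrictPartialOrder = On.isStrictPartialOrder rank
      (⊎-<-isStrictPartialOrder <-isStrictPartialOrder
        (Flip.isStrictPartialOrder <-isStrictPartialOrder))

    lower≺upper : ∀ {x y} → Lower x → ¬ Lower y → x ≺ y
    lower≺upper x∈Lower y∉Lower =
      subst₂ _⊏_ (sym (rank-lower x∈Lower)) (sym (rank-upper y∉Lower)) ₁∼₂

    lower≺lower : ∀ {x y} → Lower x → Lower y → depth x < depth y → x ≺ y
    lower≺lower x∈Lower y∈Lower depth< =
      subst₂ _⊏_ (sym (rank-lower x∈Lower)) (sym (rank-lower y∈Lower)) (₁∼₁ depth<)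

    upper≺upper : ∀ {x y} → ¬ Lower x → ¬ Lower y → height x > height y → x ≺ y
    upper≺upper x∉Lower y∉Lower height> =
      subst₂ _⊏_ (sym (rank-upper x∉Lower)) (sym (rank-upper y∉Lower)) (₂∼₂ height>)

    smaller-in-neighbour : ∀ z → z ≢ r → ∃[ w ] (Arc D ∩ _≺_) w z
    smaller-in-neighbour z z≢r = case lower? z of λ where
      (yes z∈Lower) →
        let w , (a , w∈Lower , _) , depth< =
              closer-out-neighbour (converse LowerPart) (Star.reverse id (from-r z∈Lower)) z≢r
        in w , a , lower≺lower w∈Lower z∈Lower depth<
      (no z∉Lower) →
        let w , a , w∈Lower = lower-in-neighbour z∉Lower
        in w , a , lower≺upper w∈Lower z∉Lower

    larger-out-neighbour : ∀ z → z ≢ s → ∃[ w ] (Arc D ∩ _≺_) z w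
    larger-out-neighbour z z≢s = case lower? z of λ where
      (yes z∈Lower) →
        let w , a , w∉Lower = upper-out-neighbour z∈Lower
        in w , a , lower≺upper z∈Lower w∉Lower
      (no z∉Lower) →
        let w , (a , _ , w∉Lower) , height< = closer-out-neighbour UpperPart (to-s z∉Lower) z≢s
        in w , a , upper≺upper z∉Lower w∉Lower height<

  bipolarPartition⇒bipolarSubdigraph : HasAcyclicBipolarSubdigraph D
  bipolarPartition⇒bipolarSubdigraph = strictPartialOrder⇒bipolarSubdigraph D
    ≺-isStrictPartialOrder _≺?_ smaller-in-neighbour larger-out-neighbour

-- Compositions

semicomplete⇒arc : ∀ D → Semicomplete D → ∀ {x y} → ¬ Star (Arc D) y x → Arc D x y
semicomplete⇒arc D semicomplete {x} {y} y⇝̸x with semicomplete x y (λ { refl → y⇝̸x ε })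
... | inj₁ x→y = x→y
... | inj₂ y→x = contradiction (y→x ◅ ε) y⇝̸x

strong⇒positive-walk : ∀ D → 2 ≤ order D → Strong D → ∀ x y → TransClosure (Arc D) x y
strong⇒positive-walk D 2≤∣D∣ strong x y with other-vertex D 2≤∣D∣ x
... | z , x≢z with strong x z
...   | ε     , _ = contradiction refl x≢z
...   | a ◅ w , _ = a ◅⁺ (w ◅◅ proj₁ (strong z y))

module _ (T : Digraph) (H : V T → Digraph) where

  open Composition T H using (inner; outer)

  private
    Q : Digraph
    Q = composition T H

  project-arc : ∀ {x y} → Arc Q x y → Star (Arc T) (proj₁ x) (proj₁ y)
  project-arc (inner _) = ε
  project-arc (outer a) = a ◅ ε

  project : ∀ {x y} → Star (Arc Q) x y → Star (Arc T) (proj₁ x) (proj₁ y)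
  project = Star.kleisliStar proj₁ project-arc

  lift-within : ∀ {p} {P : Pred (V Q) p} (h : ∀ i → V (H i)) → (∀ i → P (i , h i)) →
    ∀ {x y} → TransClosure (Arc T) (proj₁ x) (proj₁ y) → P x → P y →
    Star (Arc Q ∩ Within P) x y
  lift-within h h∈P [ a ]   Px Py = (outer a , Px , Py) ◅ ε
  lift-within h h∈P (a ∷ w) Px Py = (outer a , Px , h∈P _) ◅ lift-within h h∈P w (h∈P _) Py

  strong-quotient : (∀ i → V (H i)) → Strong Q → Strong T
  strong-quotient h strong = reachable⇒strong T λ i j → project (proj₁ (strong (i , h i) (j , h j)))

  composition-strong : 2 ≤ order T → (∀ i → V (H i)) → Strong T → Strong Q
  composition-strong 2≤∣T∣ h strong = reachable⇒strong Q λ (i , _) (j , _) →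
    Star.map proj₁ (lift-within h (λ _ → tt) (strong⇒positive-walk T 2≤∣T∣ strong i j) tt tt)

  nonstrong⇒bipolarPartition : 2 ≤ order T → (∀ i → V (H i)) → Semicomplete T → ¬ Strong Q →
    ∀ {r s} → (∀ z → Star (Arc Q) r z) → (∀ z → Star (Arc Q) z s) → BipolarPartition Q
  nonstrong⇒bipolarPartition 2≤∣T∣ h semicomplete ¬strong {r@(p , _)} {s@(q , _)} from-r to-s =
    record
    { Lower               = λ (i , _) → Star (Arc T) i p
    ; lower?              = λ (i , _) → reachable? T i p
    ; r                   = r
    ; s                   = s
    ; from-r              = λ {z} → backward-closed⇒within (λ a → project-arc a ◅◅_) (from-r z)
    ; to-s                = λ {z} →
        forward-closed⇒within (λ a x⇝̸p y⇝p → x⇝̸p (project-arc a ◅◅ y⇝p)) (to-s z)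
    ; upper-out-neighbour = λ i⇝p →
        s , outer (semicomplete⇒arc T semicomplete λ q⇝i → q⇝̸p (q⇝i ◅◅ i⇝p)) , q⇝̸p
    ; lower-in-neighbour  = λ i⇝̸p → r , outer (semicomplete⇒arc T semicomplete i⇝̸p) , ε
    }
    where
    q⇝̸p : ¬ Star (Arc T) q p
    q⇝̸p q⇝p = ¬strong (composition-strong 2≤∣T∣ h (reachable⇒strong T λ i j →
      project (to-s (i , h i)) ◅◅ q⇝p ◅◅ project (from-r (j , h j))))

  strong⇒bipolarPartition : 2 ≤ order T → Strong T → (a b : ∀ i → V (H i)) → (∀ i → a i ≢ b i) →
    BipolarPartition Q
  strong⇒bipolarPartition 2≤∣T∣ strong a b a≢b = record
    { Lower               = λ (i , v) → v ≡ a i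
    ; lower?              = λ (i , v) → Digraph._≟V_ (H i) v (a i)
    ; r                   = p , a p
    ; s                   = p , b p
    ; from-r              = λ {z} z≡a → lift-within a (λ _ → refl) (walk p (proj₁ z)) refl z≡a
    ; to-s                = λ {z} z≢a → lift-within b b≢a (walk (proj₁ z) p) z≢a (b≢a p)
    ; upper-out-neighbour = λ {z} _ →
        let j , i→j = first-step (walk (proj₁ z) p) in (j , b j) , outer i→j , b≢a j
    ; lower-in-neighbour  = λ {z} _ →
        let j , j→i = last-step (walk p (proj₁ z)) in (j , a j) , outer j→i , refl
    }
    where
    p : V T
    p = some-vertex T (<⇒≤ 2≤∣T∣)
    walk : ∀ i j → TransClosure (Arc T) i j
    walk = strong⇒positive-walk T 2≤∣T∣ strong
    b≢a : ∀ i → b i ≢ a i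
    b≢a i = ≢-sym (a≢b i)

theorem6p2 : (T : Digraph) (H : V T → Digraph) →
  2 ≤ order T →
  (∀ i → 1 ≤ order (H i)) →
  Semicomplete T →
  let Q = composition T H in
  (¬ Strong Q × HasInBranching Q × HasOutBranching Q) ⊎ (Strong Q × (∀ i → 2 ≤ order (H i))) →
  Σ[ S ∈ SpanningSubdigraph Q ]
    let R = SpanningSubdigraph.digraph S in
    Acyclic R ×
    (∃[ x ] ∃[ y ]
      (Digraph.IsSource R x × Digraph.IsSink R y ×
       (∀ (z : V Q) → Path (Arc R) x z × Path (Arc R) z y)))
theorem6p2 T H 2≤∣T∣ 1≤∣H∣ semicomplete (inj₁ (¬strong , B⁻ , B⁺)) =
  bipolarPartition⇒bipolarSubdigraph
    (nonstrong⇒bipolarPartition T H 2≤∣T∣ (λ i → some-vertex (H i) (1≤∣H∣ i)) semicomplete ¬strong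
      (proj₂ (outBranching⇒reachable-from (composition T H) B⁺))
      (proj₂ (inBranching⇒reachable-to (composition T H) B⁻)))
theorem6p2 T H 2≤∣T∣ 1≤∣H∣ _ (inj₂ (strong , 2≤∣H∣)) =
  bipolarPartition⇒bipolarSubdigraph
    (strong⇒bipolarPartition T H 2≤∣T∣ (strong-quotient T H a strong)
      a (proj₁ ∘ other) (proj₂ ∘ other))
  where
  a : ∀ i → V (H i)
  a i = some-vertex (H i) (1≤∣H∣ i)
  other : ∀ i → ∃[ b ] a i ≢ b
  other i = other-vertex (H i) (2≤∣H∣ i) (a i)
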